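{- Let $n\ge 1$ and let $\Phi$ be a set of proposition symbols containing $2n$ distinct symbols $p_1,\ldots,p_n,q_1,\ldots,q_n$. If $\varphi\in\mathrm{ML}(\triangledown)(\Phi)$ is a formula that describes the inclusion atom $p_1\ldots p_n\subseteq q_1\ldots q_n$, i.e. $K,T\models\varphi\iff K,T\models p_1\ldots p_n\subseteq q_1\ldots q_n$ for all Kripke models $K$ over $\Phi$ and all teams $T$ of $K$, then $\varphi$ contains at least $2^n$ symbols (counting occurrences).
   Context: Kripke models and teams. A Kripke model over a set $\Phi$ of proposition symbols is a triple $K=(W,R,V)$ with $W$ a set, $R\subseteq W\times W$, and $V:\Phi\to\mathcal{P}(W)$. A team of $K$ is any subset $T\subseteq W$. Write $R[T]=\{v\in W\mid \exists w\in T: wRv\}$, and $T[R]S$ if for every $v\in S$ there is $w\in T$ with $wRv$ and for every $w\in T$ there is $v\in S$ with $wRv$. Modal logic with nonemptiness operator $\mathrm{ML}(\triangledown)(\Phi)$: formulas are generated by $\varphi:= p\mid \neg p\mid(\varphi\land\varphi)\mid(\varphi\lor\varphi)\mid\Diamond\varphi\mid\Box\varphi\mid\triangledown\varphi$, $p\in\Phi$. Team semantics: $K,T\models p$ iff $T\subseteq V(p)$; $K,T\models\neg p$ iff $T\cap V(p)=\emptyset$; $K,T\models\varphi\land\psi$ iff $K,T\models\varphi$ and $K,T\models\psi$; $K,T\models\varphi\lor\psi$ iff there are $T_1,T_2$ with $T_1\cup T_2=T$, $K,T_1\models\varphi$ and $K,T_2\models\psi$; $K,T\models\Diamond\varphi$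 iff $K,S\models\varphi$ for some $S$ with $T[R]S$; $K,T\models\Box\varphi$ iff $K,R[T]\models\varphi$; $K,T\models\triangledown\varphi$ iff $T=\emptyset$ or there is $S\subseteq T$ with $S\neq\emptyset$ and $K,S\models\varphi$. For a state $w$, $K,w\models\varphi$ abbreviates $K,\{w\}\models\varphi$. Inclusion atom: $K,T\models p_1\ldots p_n\subseteq q_1\ldots q_n$ iff for every $w\in T$ there is $v\in T$ such that for all $1\le i\le n$: $K,w\models p_i\iff K,v\models q_i$. -}

module Defs where

open import Data.Fin.Base using (Fin)
open import Data.Nat.Base using (ℕ; suc; _+_)
open import Data.Product.Base using (∃-syntax; _×_)
open import Data.Sum.Base using (_⊎_)
open import Data.Vec.Base using (Vec; lookup)
open import Function.Bundles using (_⇔_)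
open import Level using (Lift; 0ℓ) renaming (suc to lsuc)
open import Relation.Binary.Core using (Rel)
open import Relation.Unary using (Pred; _∈_; _⊆_; _≐_; _∩_; _∪_; ｛_｝; Empty; Satisfiable)

record Kripke (Φ : Set) : Set₁ where
  field
    W : Set
    R : Rel W 0ℓ
    V : Φ → Pred W 0ℓ

-- Subsets are predicates; two teams are the same when they are
-- extensionally equal (_≐_).
Team : ∀ {Φ} → Kripke Φ → Set₁
Team K = Pred (Kripke.W K) 0ℓ

module _ {Φ : Set} (K : Kripke Φ) where
  open Kripke K

  R[_] : Team K → Team K
  R[ T ] v = ∃[ w ] w ∈ T × R w v

  _[R]_ : Team K → Team K → Set
  T [R] S = (∀ v → v ∈ S → ∃[ w ] w ∈ T × R w v)
          × (∀ w → w ∈ T → ∃[ v ] v ∈ S × R w v)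

infixr 7 _∧_
infixr 6 _∨_
infix  8 ◇_ □_ ▽_

data ML▽ (Φ : Set) : Set where
  var     : Φ → ML▽ Φ
  ¬var    : Φ → ML▽ Φ
  _∧_ _∨_ : ML▽ Φ → ML▽ Φ → ML▽ Φ
  ◇_ □_ ▽_ : ML▽ Φ → ML▽ Φ

infix 4 _∣_⊨_

-- Satisfaction quantifies over teams and hence lives in Set₁; the Lifts only
-- adjust the universe of the literal and emptiness clauses.
_∣_⊨_ : ∀ {Φ} (K : Kripke Φ) → Team K → ML▽ Φ → Set₁
K ∣ T ⊨ var p   = Lift (lsuc 0ℓ) (T ⊆ Kripke.V K p)
K ∣ T ⊨ ¬var p  = Lift (lsuc 0ℓ) (Empty (T ∩ Kripke.V K p))
K ∣ T ⊨ (φ ∧ ψ) = (K ∣ T ⊨ φ) × (K ∣ T ⊨ ψ)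
K ∣ T ⊨ (φ ∨ ψ) = ∃[ T₁ ] ∃[ T₂ ] (T₁ ∪ T₂) ≐ T × (K ∣ T₁ ⊨ φ) × (K ∣ T₂ ⊨ ψ)
K ∣ T ⊨ (◇ φ)   = ∃[ S ] (_[R]_ K T S) × (K ∣ S ⊨ φ)
K ∣ T ⊨ (□ φ)   = K ∣ R[_] K T ⊨ φ
K ∣ T ⊨ (▽ φ)   = Empty T ⊎ (∃[ S ] S ⊆ T × Satisfiable S × (K ∣ S ⊨ φ))

infix 4 _∣_⊨inc_⊆_

_∣_⊨inc_⊆_ : ∀ {Φ n} (K : Kripke Φ) → Team K → Vec Φ n → Vec Φ n → Set₁
K ∣ T ⊨inc ps ⊆ qs =
  ∀ w → w ∈ T → ∃[ v ] v ∈ T ×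
    (∀ i → (K ∣ ｛ w ｝ ⊨ var (lookup ps i)) ⇔ (K ∣ ｛ v ｝ ⊨ var (lookup qs i)))

DescribesInclusion : ∀ {Φ n} → ML▽ Φ → Vec Φ n → Vec Φ n → Set₁
DescribesInclusion {Φ} φ ps qs =
  ∀ (K : Kripke Φ) (T : Team K) → (K ∣ T ⊨ φ) ⇔ (K ∣ T ⊨inc ps ⊆ qs)

-- Number of symbol occurrences.  Parentheses are not counted; a negated
-- literal consists of two symbols.
size : ∀ {Φ} → ML▽ Φ → ℕ
size (var p)  = 1
size (¬var p) = 2
size (φ ∧ ψ)  = suc (size φ + size ψ)
size (φ ∨ ψ)  = suc (size φ + size ψ)
size (◇ φ)    = suc (size φ)
size (□ φ)    = suc (size φ)
size (▽ φ)    = suc (size φ)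

{-# OPTIONS --safe #-}

-- In a model without edges, truth of φ in a team T is certified by a subset N
-- of T with at most size φ elements (one for each ▽ used): φ holds in every
-- team between N and T.  Take as worlds all n-bit words w, with p₁…pₙ spelling
-- w and q₁…qₙ spelling its complement.  The full team satisfies the inclusion
-- atom, but it fails once any word w is removed, because only w provides the
-- q-pattern that the complement of w requires.  So N contains all 2ⁿ words.
module Submission where

open import Data.Empty using (⊥)
open import Data.Fin.Base using (Fin; suc; opposite; finToFun; funToFin; splitAt; _↑ˡ_; _↑ʳ_)
open import Data.Fin.Patterns using (0F; 1F)
open import Data.Fin.Properties
  using (_≟_; injective⇒≤; finToFun-funToFin; funToFin-finToFin; splitAt-↑ˡ; splitAt-↑ʳ)
open import Data.List.Base using (List; []; _∷_; _++_; length)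
open import Data.List.Membership.DecPropositional using (_∈?_)
open import Data.List.Membership.Propositional using () renaming (_∈_ to _∈ₗ_)
open import Data.List.Membership.Setoid.Properties using (index-injective)
open import Data.List.Properties using (length-++)
open import Data.List.Relation.Unary.All as All using (All; []; _∷_)
open import Data.List.Relation.Unary.All.Properties using (++⁺; ++⁻ˡ; ++⁻ʳ; ¬Any⇒All¬)
open import Data.List.Relation.Unary.Any using (index)
open import Data.Nat.Base using (ℕ; zero; suc; _+_; _≤_; _≥_; _^_; z≤n; s≤s)
open import Data.Nat.Properties using (≤-trans; +-mono-≤; m≤n⇒m≤1+n)
open import Data.Product.Base as Product using (_×_; _,_; ∃-syntax; proj₁)
open import Data.Sum.Base as Sum using (inj₁; inj₂; [_,_]′)
open import Data.Vec.Base using (Vec; lookup) renaming (_++_ to _++ᵥ_)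
open import Data.Vec.Properties using (lookup-++ˡ; lookup-++ʳ)
open import Data.Vec.Relation.Unary.Unique.Propositional using (Unique)
open import Data.Vec.Relation.Unary.Unique.Propositional.Properties using (lookup-injective)
open import Function.Base using (_∘_)
open import Function.Bundles using (_⇔_; mk⇔; Equivalence)
open import Function.Construct.Composition using (_⇔-∘_)
open import Function.Construct.Symmetry using (⇔-sym)
open import Level using (lift; lower)
open import Relation.Binary.PropositionalEquality
  using (_≡_; _≢_; refl; sym; trans; cong; subst; setoid)
open import Relation.Nullary.Decidable.Core using (decidable-stable)
open import Relation.Nullary.Negation.Core using (¬_; contradiction)
open import Relation.Unary using (_⊆_; _∈_; _∩_; ｛_｝; U)

open import Defs

open Equivalence using (to; from)

length-++-≤ : ∀ {A : Set} (xs ys : List A) {a b} →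
  length xs ≤ a → length ys ≤ b → length (xs ++ ys) ≤ a + b
length-++-≤ xs ys xs≤a ys≤b rewrite length-++ xs {ys} = +-mono-≤ xs≤a ys≤b

module _ {Φ : Set} (K : Kripke Φ) (¬R : ∀ w v → ¬ Kripke.R K w v) where
  open Kripke K

  -- By induction on `φ`: binary connectives concatenate the two lists, and a `▽` with a nonempty
  -- witness team adds one world, paid for by its own symbol. Literals and modalities cost nothing.
  certificate : ∀ (φ : ML▽ Φ) (T : Team K) → K ∣ T ⊨ φ →
    ∃[ N ] length N ≤ size φ × All (_∈ T) N ×
      (∀ (S : Team K) → S ⊆ T → All (_∈ S) N → K ∣ S ⊨ φ)
  certificate (var p) T (lift T⊆p) =
    [] , z≤n , [] , λ S S⊆T _ → lift (T⊆p ∘ S⊆T)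
  certificate (¬var p) T (lift T∩p≡∅) =
    [] , z≤n , [] , λ S S⊆T _ → lift λ w → T∩p≡∅ w ∘ Product.map₁ S⊆T
  certificate (φ ∧ ψ) T (⊨φ , ⊨ψ)
    with certificate φ T ⊨φ | certificate ψ T ⊨ψ
  ... | N₁ , N₁≤ , N₁⊆T , cert₁ | N₂ , N₂≤ , N₂⊆T , cert₂ =
    N₁ ++ N₂ , m≤n⇒m≤1+n (length-++-≤ N₁ N₂ N₁≤ N₂≤) , ++⁺ N₁⊆T N₂⊆T ,
    λ S S⊆T N⊆S → cert₁ S S⊆T (++⁻ˡ N₁ N⊆S) , cert₂ S S⊆T (++⁻ʳ N₁ N⊆S)
  certificate (φ ∨ ψ) T (T₁ , T₂ , (∪⊆T , T⊆∪) , ⊨φ , ⊨ψ)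
    with certificate φ T₁ ⊨φ | certificate ψ T₂ ⊨ψ
  ... | N₁ , N₁≤ , N₁⊆T₁ , cert₁ | N₂ , N₂≤ , N₂⊆T₂ , cert₂ =
    N₁ ++ N₂ , m≤n⇒m≤1+n (length-++-≤ N₁ N₂ N₁≤ N₂≤) ,
    ++⁺ (All.map (∪⊆T ∘ inj₁) N₁⊆T₁) (All.map (∪⊆T ∘ inj₂) N₂⊆T₂) ,
    -- The split of `T` is cut down to `S`. As `N₁` lies in both `S` and `T₁`, the team `S ∩ T₁` is
    -- between `N₁` and `T₁`; likewise for `T₂`.
    λ S S⊆T N⊆S → S ∩ T₁ , S ∩ T₂ ,
      ([ proj₁ , proj₁ ]′ , λ w∈S → Sum.map (w∈S ,_) (w∈S ,_) (T⊆∪ (S⊆T w∈S))) ,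
      cert₁ (S ∩ T₁) (λ (_ , w∈T₁) → w∈T₁) (All.zip (++⁻ˡ N₁ N⊆S , N₁⊆T₁)) ,
      cert₂ (S ∩ T₂) (λ (_ , w∈T₂) → w∈T₂) (All.zip (++⁻ʳ N₁ N⊆S , N₂⊆T₂))
  certificate (◇ φ) T (T′ , (T′⊆R[T] , T⊆R⁻¹[T′]) , ⊨φ) =
    -- Without edges `T′` is empty, so it makes no demand on `S`, and the forward condition passes
    -- from `T` to its subset `S`.
    [] , z≤n , [] , λ S S⊆T _ → T′ ,
      ( (λ v v∈T′ → let w , _ , wRv = T′⊆R[T] v v∈T′ in contradiction wRv (¬R w v))
      , (λ w w∈S → T⊆R⁻¹[T′] w (S⊆T w∈S))) , ⊨φ
  certificate (□ φ) T ⊨φ with certificate φ (R[_] K T) ⊨φ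
  ... | N , N≤ , N⊆R[T] , cert =
    -- Each world of `N` would be a successor, so `N` is empty and lies in `R[ S ]` vacuously.
    [] , z≤n , [] , λ S S⊆T _ →
      cert (R[_] K S) (Product.map₂ (Product.map₁ S⊆T))
        (All.map (λ {v} (w , _ , wRv) → contradiction wRv (¬R w v)) N⊆R[T])
  certificate (▽ φ) T (inj₁ T≡∅) =
    [] , z≤n , [] , λ S S⊆T _ → inj₁ (λ w → T≡∅ w ∘ S⊆T)
  certificate (▽ φ) T (inj₂ (T′ , T′⊆T , (w , w∈T′) , ⊨φ)) with certificate φ T′ ⊨φ
  ... | N , N≤ , N⊆T′ , cert =
    w ∷ N , s≤s N≤ , T′⊆T w∈T′ ∷ All.map T′⊆T N⊆T′ ,
    λ { S S⊆T (w∈S ∷ N⊆S) → inj₂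
          ( S ∩ T′ , proj₁ , (w , w∈S , w∈T′)
          , cert (S ∩ T′) (λ (_ , v∈T′) → v∈T′) (All.zip (N⊆S , N⊆T′))) }

-- Sending `i` to the position of an occurrence in `xs` is injective, since the position determines
-- the entry.
covering⇒≤length : ∀ {m} (xs : List (Fin m)) → (∀ i → i ∈ₗ xs) → m ≤ length xs
covering⇒≤length xs i∈xs =
  injective⇒≤ {f = index ∘ i∈xs} (index-injective (setoid _) (i∈xs _) (i∈xs _))

funToFin-cong : ∀ {m n} {f g : Fin m → Fin n} → (∀ i → f i ≡ g i) → funToFin f ≡ funToFin g
funToFin-cong {zero}  f≗g = refl
funToFin-cong {suc m} f≗g
  rewrite f≗g 0F | funToFin-cong (f≗g ∘ suc) = refl

opposite-≢ : ∀ (b : Fin 2) → opposite b ≢ b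
opposite-≢ 0F ()
opposite-≢ 1F ()

opposite-1F⇔0F : ∀ (b : Fin 2) → b ≡ 1F ⇔ opposite b ≡ 0F
opposite-1F⇔0F 0F = mk⇔ (λ ()) (λ ())
opposite-1F⇔0F 1F = mk⇔ (λ _ → refl) (λ _ → refl)

opposite-match : ∀ (b c : Fin 2) → opposite b ≡ 1F ⇔ c ≡ 0F → c ≡ b
opposite-match 0F 0F _ = refl
opposite-match 0F 1F e = contradiction (to e refl) λ ()
opposite-match 1F 0F e = contradiction (from e refl) λ ()
opposite-match 1F 1F _ = refl

-- Words are encoded as numbers so that extensionality of functions is not needed.
module Word (n : ℕ) where

  bit : Fin (2 ^ n) → Fin n → Fin 2
  bit = finToFun

  bit-injective : ∀ {v w} → (∀ i → bit v i ≡ bit w i) → v ≡ w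
  bit-injective {v} {w} v≗w =
    trans (sym (funToFin-finToFin {n} {2} v))
      (trans (funToFin-cong v≗w) (funToFin-finToFin {n} {2} w))

  complement : Fin (2 ^ n) → Fin (2 ^ n)
  complement w = funToFin (opposite ∘ bit w)

  bit-complement : ∀ w i → bit (complement w) i ≡ opposite (bit w i)
  bit-complement w = finToFun-funToFin (opposite ∘ bit w)

-- From `n ≥ 1` there is a first bit, and complementing flips it. The empty word would be its own
-- complement.
complement-≢ : ∀ {n} → n ≥ 1 → ∀ w → Word.complement n w ≢ w
complement-≢ {suc n} _ w eq = opposite-≢ (bit w 0F)
  (trans (sym (bit-complement w 0F)) (cong (λ v → bit v 0F) eq))
  where open Word (suc n)

｛｝⊨var : ∀ {Φ} (K : Kripke Φ) w p → (K ∣ ｛ w ｝ ⊨ var p) ⇔ w ∈ Kripke.V K p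
｛｝⊨var K w p = mk⇔ (λ ⊨p → lower ⊨p refl) (λ w∈p → lift λ { refl → w∈p })

module _ {n} {Φ : Set} (ps qs : Vec Φ n) where
  open Word n

  -- Equality on `Φ` need not be decidable, so `V` asks for a position of `x` among the symbols
  -- instead of computing one. Other symbols hold nowhere.
  wordModel : Kripke Φ
  wordModel = record
    { W = Fin (2 ^ n)
    ; R = λ _ _ → ⊥
    ; V = λ x w → ∃[ k ] lookup (ps ++ᵥ qs) k ≡ x × holds k w
    }
    where
    holds : Fin (n + n) → Fin (2 ^ n) → Set
    holds k w = [ (λ i → bit w i ≡ 1F) , (λ i → bit w i ≡ 0F) ]′ (splitAt n k)

  module _ (unique : Unique (ps ++ᵥ qs)) where
    open Kripke wordModel

    p-bit : ∀ w i → w ∈ V (lookup ps i) ⇔ bit w i ≡ 1F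
    p-bit w i = mk⇔ forth back
      where
      forth : w ∈ V (lookup ps i) → bit w i ≡ 1F
      forth (k , eq , h)
        -- Distinctness of the symbols leaves only one possible position `k`.
        with refl ← lookup-injective unique k (i ↑ˡ n) (trans eq (sym (lookup-++ˡ ps qs i)))
        rewrite splitAt-↑ˡ n i n = h
      back : bit w i ≡ 1F → w ∈ V (lookup ps i)
      back h = i ↑ˡ n , lookup-++ˡ ps qs i ,
        subst [ _ , _ ]′ (sym (splitAt-↑ˡ n i n)) h

    q-bit : ∀ w i → w ∈ V (lookup qs i) ⇔ bit w i ≡ 0F
    q-bit w i = mk⇔ forth back
      where
      forth : w ∈ V (lookup qs i) → bit w i ≡ 0F
      forth (k , eq , h)
        with refl ← lookup-injective unique k (n ↑ʳ i) (trans eq (sym (lookup-++ʳ ps qs i)))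
        rewrite splitAt-↑ʳ n n i = h
      back : bit w i ≡ 0F → w ∈ V (lookup qs i)
      back h = n ↑ʳ i , lookup-++ʳ ps qs i ,
        subst [ _ , _ ]′ (sym (splitAt-↑ʳ n n i)) h

    ⊨p⇔bit : ∀ w i → (wordModel ∣ ｛ w ｝ ⊨ var (lookup ps i)) ⇔ bit w i ≡ 1F
    ⊨p⇔bit w i = p-bit w i ⇔-∘ ｛｝⊨var wordModel w _

    ⊨q⇔bit : ∀ w i → (wordModel ∣ ｛ w ｝ ⊨ var (lookup qs i)) ⇔ bit w i ≡ 0F
    ⊨q⇔bit w i = q-bit w i ⇔-∘ ｛｝⊨var wordModel w _

    full⊨inc : wordModel ∣ U ⊨inc ps ⊆ qs
    full⊨inc w _ = complement w , _ , λ i →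
      ⇔-sym (⊨q⇔bit (complement w) i)
        ⇔-∘ (subst (λ b → bit w i ≡ 1F ⇔ b ≡ 0F) (sym (bit-complement w i))
               (opposite-1F⇔0F (bit w i))
        ⇔-∘ ⊨p⇔bit w i)

    punctured⊭inc : n ≥ 1 → ∀ w → ¬ (wordModel ∣ (_≢ w) ⊨inc ps ⊆ qs)
    -- The complement of `w` survives the puncture. Any `v` answering it has the complement of `w`
    -- as its q-pattern, hence agrees with `w` bit by bit.
    punctured⊭inc n≥1 w ⊨inc with ⊨inc (complement w) (complement-≢ n≥1 w)
    ... | v , v≢w , agree = v≢w (bit-injective λ i →
      opposite-match (bit w i) (bit v i)
        (subst (λ b → b ≡ 1F ⇔ bit v i ≡ 0F) (bit-complement w i)
          (⊨q⇔bit v i ⇔-∘ (agree i ⇔-∘ ⇔-sym (⊨p⇔bit (complement w) i)))))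

theorem5p4 : (n : ℕ) → n ≥ 1 → (Φ : Set) (ps qs : Vec Φ n) → Unique (ps ++ᵥ qs) →
    (φ : ML▽ Φ) → DescribesInclusion φ ps qs → 2 ^ n ≤ size φ
theorem5p4 n n≥1 Φ ps qs unique φ describes
  with certificate (wordModel ps qs) (λ _ _ ()) φ U
         (from (describes (wordModel ps qs) U) (full⊨inc ps qs unique))
... | N , N≤ , _ , cert = ≤-trans (covering⇒≤length N covers) N≤
  where
  covers : ∀ w → w ∈ₗ N
  -- List membership is decidable, so a missing `w` may be assumed: then `N` lies in the team
  -- without `w`, and the certificate yields `φ` there.
  covers w = decidable-stable (_∈?_ _≟_ w N) λ w∉N →
    punctured⊭inc ps qs unique n≥1 w (to (describes (wordModel ps qs) (_≢ w))
      (cert (_≢ w) _ (All.map (λ w≢v v≡w → w≢v (sym v≡w)) (¬Any⇒All¬ N w∉N))))
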